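{- If $G$ is a connected graph with $\operatorname{im}(G)<\operatorname{reg}(G)=\operatorname{m}(G)$, then $G$ is isomorphic to the $5$-cycle $C_5$.
   Context: $\operatorname{reg}(G)=\max\{j\ge0:\widetilde H_{j-1}(\operatorname{Ind}(G[S]);\Bbbk)\neq0\text{ for some }S\subseteq V(G)\}$ over a fixed field $\Bbbk$ ($\operatorname{Ind}$ = independence complex). $\operatorname{im}(G)$ is the induced matching number and $\operatorname{m}(G)$ the matching number (maximum number of pairwise vertex-disjoint edges). -}

module Defs where

open import Algebra.Apartness.Bundles using (HeytingField; HeytingCommutativeRing)
open import Algebra.Bundles using (CommutativeRing)
import Algebra.Properties.Semiring.Exp as Exp
import Algebra.Properties.Semiring.Sum as Sum
open import Data.Bool using (if_then_else_)
open import Data.Fin using (Fin; zero; suc; toℕ)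
import Data.Fin.Properties as Fin
open import Data.Fin.Subset using (Subset; inside; _∈_; _⊆_; ∣_∣)
open import Data.List using (List; length)
open import Data.List.Relation.Unary.AllPairs using (AllPairs)
open import Data.Nat using (ℕ; zero; suc; _+_; _≤_; _%_)
import Data.Nat.Properties as ℕ
open import Data.Product using (∃; _×_; _,_)
open import Data.Sum using (_⊎_; swap)
open import Data.Vec using (_∷_; lookup; _[_]≔_)
open import Function.Bundles using (_↔_; _⇔_; Inverse)
open import Level using (Level; _⊔_; 0ℓ)
open import Relation.Binary.Construct.Closure.ReflexiveTransitive using (Star)
open import Relation.Binary.Core using (Rel)
open import Relation.Binary.Definitions using (Decidable; Symmetric)
open import Relation.Binary.PropositionalEquality using (_≡_; _≢_)
open import Relation.Nullary using (¬_)
open import Relation.Nullary.Decidable using (from-yes; ¬?; _⊎-dec_)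
open import Relation.Unary using (Pred)

private
  variable
    n m : ℕ
    ℓ : Level

IsMaximum : Pred ℕ ℓ → ℕ → Set ℓ
IsMaximum P k = P k × (∀ j → P j → j ≤ k)

record Graph (n : ℕ) : Set₁ where
  field
    Adj    : Rel (Fin n) 0ℓ
    adj?   : Decidable Adj
    sym    : Symmetric Adj
    irrefl : ∀ v → ¬ Adj v v

Connected : Graph n → Set
Connected G = ∀ u v → Star (Graph.Adj G) u v

record _≅_ (G : Graph n) (H : Graph m) : Set where
  field
    bijection : Fin n ↔ Fin m
    preserves : ∀ u v → Graph.Adj G u v ⇔ Graph.Adj H (Inverse.to bijection u) (Inverse.to bijection v)

-- Vertices 0,…,4; i and j are adjacent iff j ≡ i ± 1 (mod 5).
C₅ : Graph 5
C₅ = record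
  { Adj    = Adj
  ; adj?   = adj?
  ; sym    = swap
  ; irrefl = from-yes (Fin.all? λ v → ¬? (adj? v v))
  }
  where
  Adj : Rel (Fin 5) 0ℓ
  Adj i j = suc (toℕ i) % 5 ≡ toℕ j ⊎ suc (toℕ j) % 5 ≡ toℕ i

  adj? : Decidable Adj
  adj? i j = (suc (toℕ i) % 5 ℕ.≟ toℕ j) ⊎-dec (suc (toℕ j) % 5 ℕ.≟ toℕ i)

module _ (G : Graph n) where
  open Graph G using (Adj)

  -- An edge with an arbitrary choice of orientation. Both orientations of an
  -- edge, or two copies of it, are never Disjoint, so a matching contains each
  -- edge at most once and its length is its number of edges.
  record Edge : Set where
    field
      {src tgt} : Fin n
      adj       : Adj src tgt

  _isEndOf_ : Fin n → Edge → Set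
  v isEndOf e = v ≡ Edge.src e ⊎ v ≡ Edge.tgt e

  Disjoint : Rel Edge 0ℓ
  Disjoint e f = ∀ {u v} → u isEndOf e → v isEndOf f → u ≢ v

  NotJoined : Rel Edge 0ℓ
  NotJoined e f = ∀ {u v} → u isEndOf e → v isEndOf f → ¬ Adj u v

  IsMatching : List Edge → Set
  IsMatching = AllPairs Disjoint

  IsInducedMatching : List Edge → Set
  IsInducedMatching M = IsMatching M × AllPairs NotJoined M

  IsMatchingNumber : ℕ → Set
  IsMatchingNumber = IsMaximum λ k → ∃ λ M → IsMatching M × length M ≡ k

  IsInducedMatchingNumber : ℕ → Set
  IsInducedMatchingNumber = IsMaximum λ k → ∃ λ M → IsInducedMatching M × length M ≡ k

record SimplicialComplex (n : ℕ) : Set₁ where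
  field
    Face        : Pred (Subset n) 0ℓ
    down-closed : ∀ {σ τ} → τ ⊆ σ → Face σ → Face τ

Independent : Graph n → Pred (Subset n) 0ℓ
Independent G A = ∀ {u v} → u ∈ A → v ∈ A → ¬ Graph.Adj G u v

-- Ind(G[S]): the independent sets of the induced subgraph G[S] are the
-- independent sets of G contained in S.
Ind : Graph n → Subset n → SimplicialComplex n
Ind G S = record
  { Face        = λ σ → σ ⊆ S × Independent G σ
  ; down-closed = λ τ⊆σ (σ⊆S , ind) →
      (λ v∈τ → σ⊆S (τ⊆σ v∈τ)) , λ u∈τ v∈τ → ind (τ⊆σ u∈τ) (τ⊆σ v∈τ)
  }

-- The number of elements of the subset that are smaller than v.
rank : Subset n → Fin n → ℕ
rank (_ ∷ _) zero    = 0
rank (s ∷ τ) (suc v) = (if s then 1 else 0) + rank τ v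

module ReducedHomology {c ℓ} (R : CommutativeRing c ℓ) where
  open CommutativeRing R using (Carrier; _≈_; 0#; 1#; -_; _*_; semiring)
  open Exp semiring using (_^_)
  open Sum semiring using (sum)

  -- The coefficient of τ in the boundary of Σ_σ z(σ) σ, for the standard
  -- ∂[v₀ < ⋯ < v_k] = Σᵢ (-1)ⁱ [v₀ < ⋯ v̂ᵢ ⋯ < v_k]: the simplices σ with τ as a
  -- facet are τ ∪ {v} for v ∉ τ, and v then has index rank τ v in σ. Vertices
  -- have boundary the empty face (the augmentation), and the empty face has
  -- boundary 0.
  ∂ : (Subset n → Carrier) → Subset n → Carrier
  ∂ z τ = sum λ v →
    if lookup τ v then 0# else (- 1#) ^ rank τ v * z (τ [ v ]≔ inside)

  module _ (Δ : SimplicialComplex n) where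
    open SimplicialComplex Δ using (Face)

    -- Everything is indexed by the number j of vertices of a face, i.e. by
    -- dimension + 1. The chains of C̃_{j-1}(Δ) are the functions on subsets
    -- vanishing outside the faces with j vertices.
    IsChain : ℕ → (Subset n → Carrier) → Set ℓ
    IsChain j z = ∀ σ → ¬ (Face σ × ∣ σ ∣ ≡ j) → z σ ≈ 0#

    IsCycle : ℕ → (Subset n → Carrier) → Set ℓ
    IsCycle j z = IsChain j z × (∀ τ → ∂ z τ ≈ 0#)

    IsBoundary : ℕ → (Subset n → Carrier) → Set (c ⊔ ℓ)
    IsBoundary j z = ∃ λ b → IsChain (suc j) b × (∀ τ → ∂ b τ ≈ z τ)

    -- H̃_{j-1}(Δ) ≠ 0: some cycle has non-zero class modulo boundaries.
    NonzeroHomology : ℕ → Set (c ⊔ ℓ)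
    NonzeroHomology j = ∃ λ z → IsCycle j z × ¬ IsBoundary j z

-- A Heyting field is a commutative ring with a tight apartness in which x # y
-- iff x - y is invertible; classically these are exactly the fields.
module _ {c ℓ₁ ℓ₂} (𝕜 : HeytingField c ℓ₁ ℓ₂) where
  open HeytingCommutativeRing (HeytingField.heytingCommutativeRing 𝕜) using (commutativeRing)
  open ReducedHomology commutativeRing

  IsRegularity : Graph n → ℕ → Set (c ⊔ ℓ₁)
  IsRegularity G = IsMaximum λ j → ∃ λ S → NonzeroHomology (Ind G S) j

{-# OPTIONS --safe #-}
module Submission where

-- Write P(S, k) for: G[S] has an induced subgraph that is a disjoint union of
-- p edges and q pentagons with p + 2q = k. The key claim is that P(S, k) holds
-- whenever m(G[S]) ≤ k and H̃_{k-1}(Ind(G[S])) ≠ 0; it goes by induction on |S|.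
-- If neither S ∖ v satisfies P(-, k) nor S ∖ N[v] satisfies P(-, k-1), then the
-- long exact sequence for deletion and link of v makes the homology of S vanish.
-- So P(S ∖ N[v], k-1) may be assumed for every v. If u ∈ N(v) has no neighbour in
-- the packing U of S ∖ N[v], then U ∪ {uv} is as wanted. Otherwise, as no matching
-- has more than k edges, u can only touch an edge xy of U, and v has exactly one
-- further neighbour t, which touches xy at the other end: v, u, x, y, t form a
-- pentagon. As this holds for every v, all degrees in G[S] are 2 and the pentagon
-- is not joined to the rest of U.
-- For S realising reg(G) = m(G) the packing contains a pentagon, since otherwise
-- im(G) = m(G). A vertex joined to this pentagon would give a larger matching, so
-- by connectedness the pentagon is all of G.
-- Since the homological part yields only double negations, the claim is proved in
-- the form "no packing implies acyclic", and C₅ is found by a finite search.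

open import Defs
open import Algebra.Apartness.Bundles using (HeytingField; HeytingCommutativeRing)
open import Algebra.Bundles using (CommutativeRing)
import Algebra.Properties.CommutativeMonoid.Sum as MonoidSum
import Algebra.Properties.Ring as RingProperties
import Algebra.Properties.Semiring.Exp as Exp
import Algebra.Properties.Semiring.Sum as SemiringSum
open import Data.Bool using (true; false; if_then_else_)
open import Data.Empty using (⊥-elim)
open import Data.Fin using (Fin; zero; suc; punchIn)
open import Data.Fin.Patterns using (0F; 1F; 2F; 3F; 4F)
open import Data.Fin.Properties using (_≟_; punchInᵢ≢i; any?; all?; sequence)
open import Data.Fin.Subset using (Subset; inside; outside; _∈_; _∉_; _⊆_; ∣_∣; Empty; ⊤)
open import Data.Fin.Subset.Properties using (Empty-unique; ∣⊥∣≡0; _∈?_; ∈⊤; nonempty?; p⊂q⇒∣p∣<∣q∣)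
open import Data.List as List using (List; []; _∷_; _++_; length)
import Data.List.Membership.DecPropositional as DecMembership
open import Data.List.Membership.Propositional using () renaming (_∈_ to _∈ₗ_; find to find-∈)
open import Data.List.Membership.Propositional.Properties using (∈-++⁺ˡ; ∈-++⁺ʳ; ∈-++⁻; ∈-lookup)
open import Data.List.Relation.Binary.Subset.Propositional using () renaming (_⊆_ to _⊆ₗ_)
open import Data.List.Relation.Unary.All as All using (All; []; _∷_)
import Data.List.Relation.Unary.All.Properties as All
open import Data.List.Relation.Unary.AllPairs using ([]; _∷_)
open import Data.List.Relation.Unary.Any as Any using (here; there)
open import Data.List.Relation.Unary.Any.Properties using (lookup-index)
open import Data.List.Relation.Unary.Unique.Propositional using (Unique)
import Data.List.Relation.Unary.Unique.Propositional.Properties as Unique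
open import Data.Nat using (ℕ; zero; suc; _+_; _≤_; _<_)
open import Data.Nat.Induction using (Acc; acc; <-wellFounded)
import Data.Nat.Properties as ℕ
open import Data.Product using (∃-syntax; Σ-syntax; _×_; _,_; proj₁; proj₂)
open import Data.Sum using (_⊎_; inj₁; inj₂; [_,_])
open import Data.Vec using (_∷_; lookup; _[_]≔_; tabulate)
open import Data.Vec.Properties using
  (lookup∘update; lookup∘update′; []≔-idempotent; []≔-commutes; []≔-lookup; []=⇒lookup; lookup⇒[]=; lookup∘tabulate)
open import Effect.Monad using (RawMonad)
open import Function using (_∘_; id)
open import Function.Bundles using (_↔_; _⇔_; mk⇔; mk⤖; Inverse; Equivalence)
open import Function.Construct.Symmetry using (↔-sym)
open import Function.Properties.Bijection using (⤖⇒↔)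
open import Level using (Level)
open import Relation.Binary.Construct.Closure.ReflexiveTransitive using (Star; ε; _◅_)
open import Relation.Binary.PropositionalEquality as ≡ using (_≡_; _≢_; ≢-sym; cong; cong₂)
import Relation.Binary.Reasoning.Setoid as SetoidReasoning
open import Relation.Nullary using (¬_; Dec; yes; no; does)
open import Relation.Nullary.Decidable using (dec-true; ¬?; _×-dec_; decidable-stable; from-no)
open import Relation.Nullary.Negation using (¬¬-Monad)
open import Relation.Unary using (Decidable)

-- Subsets with one element inserted or deleted, their sizes and ranks.

module _ {n : ℕ} where

  ∈-insert : ∀ {σ : Subset n} {v u} → u ∈ σ [ v ]≔ inside → u ≢ v → u ∈ σ
  ∈-insert {σ} {v} {u} u∈ u≢v =
    lookup⇒[]= u σ (≡.trans (≡.sym (lookup∘update′ u≢v σ inside)) ([]=⇒lookup u∈))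

  insert-⊇ : ∀ {σ : Subset n} {v u} → u ∈ σ → u ∈ σ [ v ]≔ inside
  insert-⊇ {σ} {v} {u} u∈ with u ≟ v
  ... | yes ≡.refl = lookup⇒[]= u _ (lookup∘update u σ inside)
  ... | no  u≢v    = lookup⇒[]= u _ (≡.trans (lookup∘update′ u≢v σ inside) ([]=⇒lookup u∈))

  ∈-inserted : ∀ (σ : Subset n) v → v ∈ σ [ v ]≔ inside
  ∈-inserted σ v = lookup⇒[]= v _ (lookup∘update v σ inside)

  insert-delete : ∀ {σ : Subset n} {v} → lookup σ v ≡ inside → (σ [ v ]≔ outside) [ v ]≔ inside ≡ σ
  insert-delete {σ} {v} σv = ≡.trans ([]≔-idempotent σ v)
    (≡.trans (cong (σ [ v ]≔_) (≡.sym σv)) ([]≔-lookup σ v))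

  delete-insert : ∀ {σ : Subset n} {v} → lookup σ v ≡ outside → (σ [ v ]≔ inside) [ v ]≔ outside ≡ σ
  delete-insert {σ} {v} σv = ≡.trans ([]≔-idempotent σ v)
    (≡.trans (cong (σ [ v ]≔_) (≡.sym σv)) ([]≔-lookup σ v))

  lookup⇒∉ : ∀ {σ : Subset n} {v} → lookup σ v ≡ outside → v ∉ σ
  lookup⇒∉ σv v∈ with () ← ≡.trans (≡.sym σv) ([]=⇒lookup v∈)

rank-≔ : ∀ {n} (σ : Subset n) v s → rank (σ [ v ]≔ s) v ≡ rank σ v
rank-≔ (_ ∷ σ) zero    s = ≡.refl
rank-≔ (t ∷ σ) (suc v) s = cong ((if t then 1 else 0) +_) (rank-≔ σ v s)

∣insert∣ : ∀ {n} (σ : Subset n) v → lookup σ v ≡ outside → ∣ σ [ v ]≔ inside ∣ ≡ suc ∣ σ ∣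
∣insert∣ (false ∷ σ) zero    _  = ≡.refl
∣insert∣ (true  ∷ σ) (suc v) σv = cong suc (∣insert∣ σ v σv)
∣insert∣ (false ∷ σ) (suc v) σv = ∣insert∣ σ v σv

-- Exactly one of u < v and v < u holds, so inserting u and deleting v change
-- the two ranks by 1 in total.
rank-exchange : ∀ {n} (τ : Subset n) u v → u ≢ v → lookup τ u ≡ outside → lookup τ v ≡ inside →
  rank τ u + rank (τ [ u ]≔ inside) v ≡ suc (rank τ v + rank (τ [ v ]≔ outside) u)
rank-exchange (_ ∷ _)     zero    zero    u≢v _  _  = ⊥-elim (u≢v ≡.refl)
rank-exchange (false ∷ τ) zero    (suc v) _   _  _  = cong suc (≡.sym (ℕ.+-identityʳ _))
rank-exchange (true ∷ τ)  (suc u) zero    _   _  _  = cong suc (ℕ.+-identityʳ _)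
rank-exchange (false ∷ τ) (suc u) (suc v) u≢v τu τv = rank-exchange τ u v (u≢v ∘ cong suc) τu τv
rank-exchange (true ∷ τ)  (suc u) (suc v) u≢v τu τv = cong suc (≡.trans (ℕ.+-suc _ _)
  (≡.trans (cong suc (rank-exchange τ u v (u≢v ∘ cong suc) τu τv)) (cong suc (≡.sym (ℕ.+-suc _ _)))))

-- Subsets cut out by decidable predicates: deleting a vertex or its closed neighbourhood.

module _ {n : ℕ} {p : Level} {P : Fin n → Set p} (P? : Decidable P) where

  select : Subset n
  select = tabulate (does ∘ P?)

  ∈-select⁺ : ∀ {v} → P v → v ∈ select
  ∈-select⁺ {v} Pv = lookup⇒[]= v _ (≡.trans (lookup∘tabulate _ v) (dec-true (P? v) Pv))

  ∈-select⁻ : ∀ {v} → v ∈ select → P v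
  ∈-select⁻ {v} v∈ with P? v in eq
  ... | yes Pv = Pv
  ... | no  _  with () ← ≡.trans (≡.sym (≡.trans (lookup∘tabulate _ v) (cong does eq))) ([]=⇒lookup v∈)

module _ {n : ℕ} where

  in-without? : ∀ (S : Subset n) v → Decidable λ u → u ∈ S × u ≢ v
  in-without? S v u = u ∈? S ×-dec ¬? (u ≟ v)

  without : Subset n → Fin n → Subset n
  without S v = select (in-without? S v)

  ∈-without⁺ : ∀ {S u v} → u ∈ S → u ≢ v → u ∈ without S v
  ∈-without⁺ {S} {v = v} u∈S u≢v = ∈-select⁺ (in-without? S v) (u∈S , u≢v)

  ∈-without⁻ : ∀ {S u v} → u ∈ without S v → u ∈ S × u ≢ v
  ∈-without⁻ {S} {v = v} = ∈-select⁻ (in-without? S v)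

module _ {n : ℕ} (G : Graph n) where
  open Graph G

  in-awayFrom? : ∀ (S : Subset n) v → Decidable λ u → u ∈ S × u ≢ v × ¬ Adj v u
  in-awayFrom? S v u = u ∈? S ×-dec ¬? (u ≟ v) ×-dec ¬? (adj? v u)

  awayFrom : Subset n → Fin n → Subset n
  awayFrom S v = select (in-awayFrom? S v)

  ∈-awayFrom⁺ : ∀ {S u v} → u ∈ S → u ≢ v → ¬ Adj v u → u ∈ awayFrom S v
  ∈-awayFrom⁺ {S} {v = v} u∈S u≢v v≁u = ∈-select⁺ (in-awayFrom? S v) (u∈S , u≢v , v≁u)

  ∈-awayFrom⁻ : ∀ {S u v} → u ∈ awayFrom S v → u ∈ S × u ≢ v × ¬ Adj v u
  ∈-awayFrom⁻ {S} {v = v} = ∈-select⁻ (in-awayFrom? S v)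

  independent-insert : ∀ {v τ} → Independent G τ → (∀ {u} → u ∈ τ → ¬ Adj v u) →
    Independent G (τ [ v ]≔ inside)
  independent-insert {v} ind v≁ {x} {y} x∈ y∈ with x ≟ v | y ≟ v
  ... | yes ≡.refl | yes ≡.refl = irrefl v
  ... | yes ≡.refl | no y≢v     = v≁ (∈-insert y∈ y≢v)
  ... | no x≢v     | yes ≡.refl = v≁ (∈-insert x∈ x≢v) ∘ sym
  ... | no x≢v     | no y≢v     = ind (∈-insert x∈ x≢v) (∈-insert y∈ y≢v)

  insert-⊆ : ∀ {v} {τ S : Subset n} → v ∈ S → τ ⊆ S → τ [ v ]≔ inside ⊆ S
  insert-⊆ {v} v∈S τ⊆S {x} x∈ with x ≟ v
  ... | yes ≡.refl = v∈S
  ... | no x≢v     = τ⊆S (∈-insert x∈ x≢v)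

-- Chains over a commutative ring: signs and the boundary operator.

module _ {c ℓ : Level} (R : CommutativeRing c ℓ) where
  open CommutativeRing R renaming (_+_ to _⊕_)
  open Exp semiring using (_^_; ^-homo-*)
  open MonoidSum +-commutativeMonoid using (sum; sum-remove; ∑-distrib-+; sum-cong-≋; sum-replicate-zero)
  open SemiringSum semiring using (*-distribˡ-sum)
  open RingProperties ring using (-1*x≈-x; -‿distribˡ-*; -‿distribʳ-*; -‿involutive; +-cancelʳ; -0#≈0#)
  open ReducedHomology R
  open SetoidReasoning setoid

  sum-single : ∀ {n} (f : Fin n → Carrier) v → (∀ u → u ≢ v → f u ≈ 0#) → sum f ≈ f v
  sum-single {suc n} f v f≈0 = begin
    sum f                         ≈⟨ sum-remove {i = v} f ⟩
    f v ⊕ sum (f ∘ punchIn v)     ≈⟨ +-congˡ (sum-cong-≋ (λ u → f≈0 (punchIn v u) (punchInᵢ≢i v u))) ⟩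
    f v ⊕ sum {n} (λ _ → 0#)      ≈⟨ +-congˡ (sum-replicate-zero n) ⟩
    f v ⊕ 0#                      ≈⟨ +-identityʳ _ ⟩
    f v                           ∎

  Chain : ℕ → Set c
  Chain n = Subset n → Carrier

  sign : ∀ {n} → Subset n → Fin n → Carrier
  sign σ v = (- 1#) ^ rank σ v

  -1^k*-1^k : ∀ k → (- 1#) ^ k * (- 1#) ^ k ≈ 1#
  -1^k*-1^k zero    = *-identityˡ 1#
  -1^k*-1^k (suc k) = begin
    (- 1# * p) * (- 1# * p)   ≈⟨ *-cong (-1*x≈-x p) (-1*x≈-x p) ⟩
    - p * - p                 ≈⟨ -‿distribˡ-* p (- p) ⟨
    - (p * - p)               ≈⟨ -‿cong (sym (-‿distribʳ-* p p)) ⟩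
    - - (p * p)               ≈⟨ -‿involutive _ ⟩
    p * p                     ≈⟨ -1^k*-1^k k ⟩
    1#                        ∎
    where p = (- 1#) ^ k

  sign-cancel : ∀ {n} (σ τ : Subset n) v x → rank σ v ≡ rank τ v → sign σ v * (sign τ v * x) ≈ x
  sign-cancel σ τ v x eq = begin
    sign σ v * (sign τ v * x)   ≡⟨ cong (λ k → (- 1#) ^ k * (sign τ v * x)) eq ⟩
    sign τ v * (sign τ v * x)   ≈⟨ *-assoc _ _ _ ⟨
    sign τ v * sign τ v * x     ≈⟨ *-congʳ (-1^k*-1^k (rank τ v)) ⟩
    1# * x                      ≈⟨ *-identityˡ x ⟩
    x                           ∎

  -- The exponents differ by one by `rank-exchange`. This is the sign rule that makes inserting `u`
  -- and deleting `v` anticommute.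
  sign-exchange : ∀ {n} (τ : Subset n) u v → u ≢ v → lookup τ u ≡ outside → lookup τ v ≡ inside →
    sign τ u * sign (τ [ u ]≔ inside) v ≈ - (sign τ v * sign (τ [ v ]≔ outside) u)
  sign-exchange τ u v u≢v τu τv = begin
    sign τ u * sign (τ [ u ]≔ inside) v
      ≈⟨ ^-homo-* (- 1#) (rank τ u) _ ⟨
    (- 1#) ^ (rank τ u + rank (τ [ u ]≔ inside) v)
      ≡⟨ cong ((- 1#) ^_) (rank-exchange τ u v u≢v τu τv) ⟩
    - 1# * (- 1#) ^ (rank τ v + rank (τ [ v ]≔ outside) u)
      ≈⟨ -1*x≈-x _ ⟩
    - (- 1#) ^ (rank τ v + rank (τ [ v ]≔ outside) u)
      ≈⟨ -‿cong (^-homo-* (- 1#) (rank τ v) _) ⟩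
    - (sign τ v * sign (τ [ v ]≔ outside) u) ∎

  -- `∂ z τ` unfolds to `sum (term z τ)`.
  term : ∀ {n} → Chain n → Subset n → Fin n → Carrier
  term z τ v = if lookup τ v then 0# else sign τ v * z (τ [ v ]≔ inside)

  ∂-additive : ∀ {n} (x y : Chain n) {z} → (∀ σ → z σ ≈ x σ ⊕ y σ) → ∀ τ → ∂ z τ ≈ ∂ x τ ⊕ ∂ y τ
  ∂-additive x y {z} z≈ τ = trans (sum-cong-≋ step) (∑-distrib-+ (term x τ) (term y τ))
    where
    step : ∀ v → term z τ v ≈ term x τ v ⊕ term y τ v
    step v with lookup τ v
    ... | true  = sym (+-identityʳ 0#)
    ... | false = trans (*-congˡ (z≈ _)) (distribˡ _ _ _)

  ∂-zero : ∀ {n} (z : Chain n) τ → (∀ v → z (τ [ v ]≔ inside) ≈ 0#) → ∂ z τ ≈ 0#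
  ∂-zero {n} z τ z≈0 = trans (sum-cong-≋ step) (sum-replicate-zero n)
    where
    step : ∀ v → term z τ v ≈ 0#
    step v with lookup τ v
    ... | true  = refl
    ... | false = trans (*-congˡ (z≈0 v)) (zeroʳ _)

  -- The cone operator, and the link and deletion parts of a chain at a vertex.

  module Cone {n : ℕ} (v : Fin n) where

    -- `cone b` is the chain of the oriented simplices `[v, τ]` with coefficients `b τ`, where the
    -- sign moves `v` to its sorted place. `link z` and `deletion z` are the parts in
    -- `z = deletion z + cone (link z)`.
    cone link deletion : Chain n → Chain n
    cone b σ     = if lookup σ v then sign σ v * b (σ [ v ]≔ outside) else 0#
    link z σ     = if lookup σ v then 0# else sign σ v * z (σ [ v ]≔ inside)
    deletion z σ = if lookup σ v then 0# else z σ

    cone-in : ∀ b {σ} → lookup σ v ≡ inside → cone b σ ≈ sign σ v * b (σ [ v ]≔ outside)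
    cone-in b σv rewrite σv = refl

    cone-out : ∀ b {σ} → lookup σ v ≡ outside → cone b σ ≈ 0#
    cone-out b σv rewrite σv = refl

    link-in : ∀ z {σ} → lookup σ v ≡ inside → link z σ ≈ 0#
    link-in z σv rewrite σv = refl

    link-out : ∀ z {σ} → lookup σ v ≡ outside → link z σ ≈ sign σ v * z (σ [ v ]≔ inside)
    link-out z σv rewrite σv = refl

    deletion-in : ∀ z {σ} → lookup σ v ≡ inside → deletion z σ ≈ 0#
    deletion-in z σv rewrite σv = refl

    cone-zero : ∀ {b} → (∀ σ → lookup σ v ≡ outside → b σ ≈ 0#) → ∀ σ → cone b σ ≈ 0#
    cone-zero b≈0 σ with lookup σ v
    ... | true  = trans (*-congˡ (b≈0 _ (lookup∘update v σ outside))) (zeroʳ _)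
    ... | false = refl

    -- The cone operator is a chain homotopy from the identity to 0 on the full simplex.
    cone-homotopy : ∀ b τ → ∂ (cone b) τ ⊕ cone (∂ b) τ ≈ b τ
    cone-homotopy b τ with lookup τ v in τv
    -- Only the insertion of `v` itself leads to a face on which `cone b` can be non-zero.
    ... | false = trans (+-identityʳ _) (begin
      sum (term (cone b) τ)   ≈⟨ sum-single _ v off-v ⟩
      term (cone b) τ v       ≡⟨ cong (if_then 0# else sign τ v * cone b (τ [ v ]≔ inside)) τv ⟩
      sign τ v * cone b (τ [ v ]≔ inside)
        ≈⟨ *-congˡ (cone-in b (lookup∘update v τ inside)) ⟩
      sign τ v * (sign (τ [ v ]≔ inside) v * b ((τ [ v ]≔ inside) [ v ]≔ outside))
        ≈⟨ sign-cancel τ (τ [ v ]≔ inside) v _ (≡.sym (rank-≔ τ v inside)) ⟩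
      b ((τ [ v ]≔ inside) [ v ]≔ outside)
        ≡⟨ cong b (delete-insert τv) ⟩
      b τ ∎)
      where
      off-v : ∀ u → u ≢ v → term (cone b) τ u ≈ 0#
      off-v u u≢v with lookup τ u
      ... | true  = refl
      ... | false = trans
        (*-congˡ (cone-out b (≡.trans (lookup∘update′ (u≢v ∘ ≡.sym) τ inside) τv))) (zeroʳ _)
    -- The two sums are merged termwise. For `u ≠ v` the terms cancel by `sign-exchange`; at `v` the
    -- first term is zero and the second returns `b τ`.
    ... | true = begin
      sum (term (cone b) τ) ⊕ sign τ v * sum (term b τ′)
        ≈⟨ +-congˡ (*-distribˡ-sum (sign τ v) (term b τ′)) ⟩
      sum (term (cone b) τ) ⊕ sum (λ u → sign τ v * term b τ′ u)
        ≈⟨ ∑-distrib-+ (term (cone b) τ) (λ u → sign τ v * term b τ′ u) ⟨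
      sum both
        ≈⟨ sum-single _ v off-v ⟩
      both v
        ≡⟨ cong₂ (λ s t → (if s then 0# else sign τ v * cone b (τ [ v ]≔ inside)) ⊕
                           sign τ v * (if t then 0# else sign τ′ v * b (τ′ [ v ]≔ inside)))
             τv (lookup∘update v τ outside) ⟩
      0# ⊕ sign τ v * (sign τ′ v * b (τ′ [ v ]≔ inside))
        ≈⟨ +-identityˡ _ ⟩
      sign τ v * (sign τ′ v * b (τ′ [ v ]≔ inside))
        ≈⟨ sign-cancel τ τ′ v _ (≡.sym (rank-≔ τ v outside)) ⟩
      b (τ′ [ v ]≔ inside)
        ≡⟨ cong b (insert-delete τv) ⟩
      b τ ∎
      where
      τ′ = τ [ v ]≔ outside
      both : Fin n → Carrier
      both u = term (cone b) τ u ⊕ sign τ v * term b τ′ u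
      off-v : ∀ u → u ≢ v → both u ≈ 0#
      off-v u u≢v rewrite lookup∘update′ u≢v τ outside with lookup τ u in τu
      ... | true  = trans (+-identityˡ _) (zeroʳ _)
      ... | false = begin
        sign τ u * cone b (τ [ u ]≔ inside) ⊕ sign τ v * (sign τ′ u * b (τ′ [ u ]≔ inside))
          ≈⟨ +-cong (*-congˡ (cone-in b (≡.trans (lookup∘update′ (u≢v ∘ ≡.sym) τ inside) τv)))
                    (sym (*-assoc _ _ _)) ⟩
        sign τ u * (sign (τ [ u ]≔ inside) v * b ((τ [ u ]≔ inside) [ v ]≔ outside))
          ⊕ sign τ v * sign τ′ u * b (τ′ [ u ]≔ inside)
          ≈⟨ +-congʳ (sym (*-assoc _ _ _)) ⟩
        sign τ u * sign (τ [ u ]≔ inside) v * b ((τ [ u ]≔ inside) [ v ]≔ outside)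
          ⊕ sign τ v * sign τ′ u * b (τ′ [ u ]≔ inside)
          ≈⟨ +-congʳ (*-cong (sign-exchange τ u v u≢v τu τv) (reflexive (cong b ([]≔-commutes τ u v u≢v)))) ⟩
        - (sign τ v * sign τ′ u) * b (τ′ [ u ]≔ inside)
          ⊕ sign τ v * sign τ′ u * b (τ′ [ u ]≔ inside)
          ≈⟨ +-congʳ (sym (-‿distribˡ-* _ _)) ⟩
        - (sign τ v * sign τ′ u * b (τ′ [ u ]≔ inside))
          ⊕ sign τ v * sign τ′ u * b (τ′ [ u ]≔ inside)
          ≈⟨ -‿inverseˡ _ ⟩
        0# ∎

    deletion+cone-link : ∀ z σ → z σ ≈ deletion z σ ⊕ cone (link z) σ
    deletion+cone-link z σ with lookup σ v in σv
    ... | false = sym (+-identityʳ _)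
    ... | true  = sym (begin
      0# ⊕ sign σ v * link z (σ [ v ]≔ outside)
        ≈⟨ +-identityˡ _ ⟩
      sign σ v * link z (σ [ v ]≔ outside)
        ≈⟨ *-congˡ (link-out z (lookup∘update v σ outside)) ⟩
      sign σ v * (sign (σ [ v ]≔ outside) v * z ((σ [ v ]≔ outside) [ v ]≔ inside))
        ≈⟨ sign-cancel σ (σ [ v ]≔ outside) v _ (≡.sym (rank-≔ σ v outside)) ⟩
      z ((σ [ v ]≔ outside) [ v ]≔ inside)
        ≡⟨ cong z (insert-delete σv) ⟩
      z σ ∎)

    module _ (z : Chain n) (∂z≈0 : ∀ τ → ∂ z τ ≈ 0#) where

      private
        w : Chain n
        w = link z

      ∂deletion+∂cone-link : ∀ τ → ∂ (deletion z) τ ⊕ ∂ (cone w) τ ≈ 0#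
      ∂deletion+∂cone-link τ = trans (sym (∂-additive (deletion z) (cone w) (deletion+cone-link z) τ)) (∂z≈0 τ)

      -- On faces through `v` the boundary of `deletion z` vanishes, hence so does that of `cone w`.
      -- The homotopy formula then gives `cone (∂ w) = w = 0` there, and its value at `τ` with `v`
      -- inserted is `∂ w τ` up to sign.
      ∂link≈0 : ∀ τ → ∂ w τ ≈ 0#
      ∂link≈0 τ with lookup τ v in τv
      ... | true  = ∂-zero w τ λ u → link-in z {τ [ u ]≔ inside} ([]=⇒lookup (insert-⊇ (lookup⇒[]= v τ τv)))
      ... | false = begin
        ∂ w τ                                 ≈⟨ sign-cancel τ⁺ τ⁺ v _ ≡.refl ⟨
        sign τ⁺ v * (sign τ⁺ v * ∂ w τ)       ≡⟨ cong (λ τ → sign τ⁺ v * (sign τ⁺ v * ∂ w τ)) (delete-insert τv) ⟨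
        sign τ⁺ v * (sign τ⁺ v * ∂ w (τ⁺ [ v ]≔ outside)) ≈⟨ *-congˡ (cone-in (∂ w) τ⁺v) ⟨
        sign τ⁺ v * cone (∂ w) τ⁺             ≈⟨ *-congˡ cone-∂w ⟩
        sign τ⁺ v * 0#                        ≈⟨ zeroʳ _ ⟩
        0#                                    ∎
        where
        τ⁺ = τ [ v ]≔ inside
        τ⁺v = lookup∘update v τ inside
        ∂cone-w : ∂ (cone w) τ⁺ ≈ 0#
        ∂cone-w = begin
          ∂ (cone w) τ⁺                         ≈⟨ +-identityˡ _ ⟨
          0# ⊕ ∂ (cone w) τ⁺
            ≈⟨ +-congʳ (∂-zero (deletion z) τ⁺ λ u → deletion-in z {τ⁺ [ u ]≔ inside} ([]=⇒lookup (insert-⊇ (lookup⇒[]= v τ⁺ τ⁺v)))) ⟨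
          ∂ (deletion z) τ⁺ ⊕ ∂ (cone w) τ⁺     ≈⟨ ∂deletion+∂cone-link τ⁺ ⟩
          0#                                    ∎
        cone-∂w : cone (∂ w) τ⁺ ≈ 0#
        cone-∂w = begin
          cone (∂ w) τ⁺                         ≈⟨ +-identityˡ _ ⟨
          0# ⊕ cone (∂ w) τ⁺                    ≈⟨ +-congʳ ∂cone-w ⟨
          ∂ (cone w) τ⁺ ⊕ cone (∂ w) τ⁺         ≈⟨ cone-homotopy w τ⁺ ⟩
          w τ⁺                                  ≈⟨ link-in z τ⁺v ⟩
          0#                                    ∎

      module _ (b : Chain n) (∂b≈w : ∀ τ → ∂ b τ ≈ w τ) where

        -- By the homotopy formula `cone w` has boundary `w`, as `b` has. Replacing the part
        -- `cone w` of the cycle `z` by `b` therefore gives a cycle again.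
        ∂[deletion+b]≈0 : ∀ τ → ∂ (λ σ → deletion z σ ⊕ b σ) τ ≈ 0#
        ∂[deletion+b]≈0 τ = begin
          ∂ (λ σ → deletion z σ ⊕ b σ) τ        ≈⟨ ∂-additive (deletion z) b (λ _ → refl) τ ⟩
          ∂ (deletion z) τ ⊕ ∂ b τ              ≈⟨ +-congˡ (∂b≈w τ) ⟩
          ∂ (deletion z) τ ⊕ w τ                ≈⟨ +-congˡ (cone-homotopy w τ) ⟨
          ∂ (deletion z) τ ⊕ (∂ (cone w) τ ⊕ cone (∂ w) τ)
            ≈⟨ +-congˡ (+-congˡ (cone-zero (λ σ _ → ∂link≈0 σ) τ)) ⟩
          ∂ (deletion z) τ ⊕ (∂ (cone w) τ ⊕ 0#) ≈⟨ +-congˡ (+-identityʳ _) ⟩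
          ∂ (deletion z) τ ⊕ ∂ (cone w) τ       ≈⟨ ∂deletion+∂cone-link τ ⟩
          0#                                    ∎

        -- The homotopy formula reads `∂ (cone b) = b - cone w`, so subtracting `cone b` from `b′`
        -- turns the boundary `deletion z + b` into `deletion z + cone w = z`.
        ∂[b′-cone]≈z : ∀ {b′} → (∀ τ → ∂ b′ τ ≈ deletion z τ ⊕ b τ) →
          ∀ τ → ∂ (λ σ → b′ σ ⊕ - cone b σ) τ ≈ z τ
        -- With `∂ (cone b) τ` added to both sides, additivity of `∂` suffices and no rule for
        -- negated chains is called for.
        ∂[b′-cone]≈z {b′} ∂b′ τ = +-cancelʳ (∂ (cone b) τ) _ _ (begin
          ∂ (λ σ → b′ σ ⊕ - cone b σ) τ ⊕ ∂ (cone b) τ  ≈⟨ ∂-additive (λ σ → b′ σ ⊕ - cone b σ) (cone b) split τ ⟨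
          ∂ b′ τ                                      ≈⟨ ∂b′ τ ⟩
          deletion z τ ⊕ b τ                          ≈⟨ +-congˡ (cone-homotopy b τ) ⟨
          deletion z τ ⊕ (∂ (cone b) τ ⊕ cone (∂ b) τ)
            ≈⟨ +-congˡ (trans (+-comm _ _) (+-congʳ (cone-cong ∂b≈w τ))) ⟩
          deletion z τ ⊕ (cone w τ ⊕ ∂ (cone b) τ)    ≈⟨ +-assoc _ _ _ ⟨
          deletion z τ ⊕ cone w τ ⊕ ∂ (cone b) τ      ≈⟨ +-congʳ (deletion+cone-link z τ) ⟨
          z τ ⊕ ∂ (cone b) τ                          ∎)
          where
          split : ∀ σ → b′ σ ≈ b′ σ ⊕ - cone b σ ⊕ cone b σ
          split σ = sym (trans (+-assoc _ _ _) (trans (+-congˡ (-‿inverseˡ _)) (+-identityʳ _)))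
          cone-cong : ∀ {x y} → (∀ σ → x σ ≈ y σ) → ∀ σ → cone x σ ≈ cone y σ
          cone-cong x≈y σ with lookup σ v
          ... | true  = *-congˡ (x≈y _)
          ... | false = refl

    module _ {Δ₁ Δ₂ : SimplicialComplex n} where
      open SimplicialComplex

      -- Two complexes are allowed because cones are formed inside one complex over an isolated
      -- vertex, and also from the link of `v` into the whole complex.
      cone-chain : ∀ {j b} → (∀ {τ} → v ∉ τ → Face Δ₁ τ → Face Δ₂ (τ [ v ]≔ inside)) →
        IsChain Δ₁ j b → IsChain Δ₂ (suc j) (cone b)
      cone-chain {j} {b} insert chain σ ¬face with lookup σ v in σv
      ... | false = refl
      ... | true  = trans (*-congˡ (chain σ′ λ (face , size) → ¬face
          ( ≡.subst (Face Δ₂) (insert-delete σv) (insert (lookup⇒∉ σ′v) face)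
          , ≡.trans (cong ∣_∣ (≡.sym (insert-delete {σ = σ} σv))) (≡.trans (∣insert∣ σ′ v σ′v) (cong suc size)))))
        (zeroʳ _)
        where
        σ′ = σ [ v ]≔ outside
        σ′v = lookup∘update v σ outside

      link-chain : ∀ {j z} → (∀ {τ} → v ∉ τ → Face Δ₁ (τ [ v ]≔ inside) → Face Δ₂ τ) →
        IsChain Δ₁ (suc j) z → IsChain Δ₂ j (link z)
      link-chain {j} {z} delete chain σ ¬face with lookup σ v in σv
      ... | true  = refl
      ... | false = trans (*-congˡ (chain _ λ (face , size) → ¬face
          (delete (lookup⇒∉ σv) face , ℕ.suc-injective (≡.trans (≡.sym (∣insert∣ σ v σv)) size))))
        (zeroʳ _)

  -- The double negation lets the inductive proof argue by cases on statements that it does not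
  -- decide, and still refutes `NonzeroHomology`.
  Acyclic : ∀ {n} → SimplicialComplex n → ℕ → Set _
  Acyclic Δ j = ∀ z → IsCycle Δ j z → ¬ ¬ IsBoundary Δ j z

  -- Acyclicity criteria for independence complexes.

  module _ {n : ℕ} (G : Graph n) where
    open Graph G using (Adj)

    -- The only face is the empty one, which has index 0, so every chain of positive index is zero.
    acyclic-empty : ∀ {S j} → Empty S → Acyclic (Ind G S) (suc j)
    acyclic-empty {S} {j} S-empty z (chain , _) ¬boundary =
      ¬boundary ((λ _ → 0#) , (λ _ _ → refl) , λ τ → trans (∂-zero _ τ λ _ → refl) (sym (chain τ no-face)))
      where
      no-face : ∀ {τ} → ¬ (SimplicialComplex.Face (Ind G S) τ × ∣ τ ∣ ≡ suc j)
      no-face ((τ⊆S , _) , size)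
        with () ← ≡.trans (≡.sym size) (≡.trans (cong ∣_∣ (Empty-unique λ (u , u∈) → S-empty (u , τ⊆S u∈))) (∣⊥∣≡0 n))

    -- The complex is a cone with apex `v`, so a cycle `z` is the boundary of `cone z`.
    acyclic-isolated : ∀ {S v j} → v ∈ S → (∀ {u} → u ∈ S → ¬ Adj v u) → Acyclic (Ind G S) j
    acyclic-isolated {S} {v} v∈S isolated z (chain , ∂z≈0) ¬boundary = ¬boundary
      ( cone z
      , cone-chain {Δ₁ = Ind G S} {Δ₂ = Ind G S} insert chain
      , λ τ → trans (sym (+-identityʳ _))
          (trans (+-congˡ (sym (cone-zero (λ σ _ → ∂z≈0 σ) τ))) (cone-homotopy z τ)))
      where
      open Cone v
      open SimplicialComplex (Ind G S) using (Face)
      insert : ∀ {τ} → v ∉ τ → Face τ → Face (τ [ v ]≔ inside)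
      insert _ (τ⊆S , ind) = insert-⊆ G v∈S τ⊆S , independent-insert G ind (λ u∈τ → isolated (τ⊆S u∈τ))

    -- The part of the long exact sequence of the pair (Ind G[S], Ind G[S ∖ v]) around H̃(Ind G[S]).
    acyclic-step : ∀ {S v j} → v ∈ S → Acyclic (Ind G (without S v)) (suc j) →
      Acyclic (Ind G (awayFrom G S v)) j → Acyclic (Ind G S) (suc j)
    acyclic-step {S} {v} {j} v∈S acyclic-deletion acyclic-link z (chain , ∂z≈0) ¬boundary =
      -- First `b` fills the cycle `link z` in the link, then `b′` fills `deletion z + b` in the
      -- deletion; `b′ - cone b` fills `z`.
      acyclic-link (link z) (link-chain {Δ₁ = Δ} {Δ₂ = Λ} to-link chain , ∂link≈0 z ∂z≈0)
        λ (b , b-chain , ∂b≈w) →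
      acyclic-deletion (λ σ → deletion z σ ⊕ b σ)
        (deletion-chain b-chain , ∂[deletion+b]≈0 z ∂z≈0 b ∂b≈w)
        λ (b′ , b′-chain , ∂b′≈) → ¬boundary
          ( (λ σ → b′ σ ⊕ - cone b σ)
          , (λ σ ¬face → trans (+-cong
              (b′-chain σ λ (face , size) → ¬face (from-deletion face , size))
              (trans (-‿cong (cone-chain {Δ₁ = Λ} {Δ₂ = Δ} from-link b-chain σ ¬face)) -0#≈0#))
              (+-identityʳ 0#))
          , ∂[b′-cone]≈z z ∂z≈0 b ∂b≈w {b′} ∂b′≈)
      where
      open Cone v
      open SimplicialComplex using (Face)
      Δ = Ind G S
      Λ = Ind G (awayFrom G S v)
      Δ∖v = Ind G (without S v)
      to-link : ∀ {τ} → v ∉ τ → Face Δ (τ [ v ]≔ inside) → Face Λ τ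
      to-link {τ} v∉τ (⊆S , ind) =
        (λ u∈τ → ∈-awayFrom⁺ G (⊆S (insert-⊇ u∈τ)) (λ { ≡.refl → v∉τ u∈τ })
          (ind (∈-inserted τ v) (insert-⊇ u∈τ))) ,
        λ x∈ y∈ → ind (insert-⊇ x∈) (insert-⊇ y∈)
      from-link : ∀ {τ} → v ∉ τ → Face Λ τ → Face Δ (τ [ v ]≔ inside)
      from-link _ (τ⊆ , ind) =
        insert-⊆ G v∈S (λ u∈ → proj₁ (∈-awayFrom⁻ G (τ⊆ u∈))) ,
        independent-insert G ind (λ u∈ → proj₂ (proj₂ (∈-awayFrom⁻ G (τ⊆ u∈))))
      from-deletion : ∀ {τ} → Face Δ∖v τ → Face Δ τ
      from-deletion (τ⊆ , ind) = (λ u∈ → proj₁ (∈-without⁻ (τ⊆ u∈))) , ind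
      link⇒deletion : ∀ {τ} → Face Λ τ → Face Δ∖v τ
      link⇒deletion (τ⊆ , ind) =
        (λ u∈ → let u∈S , u≢v , _ = ∈-awayFrom⁻ G (τ⊆ u∈) in ∈-without⁺ u∈S u≢v) , ind
      deletion-chain : ∀ {b} → IsChain Λ (suc j) b → IsChain Δ∖v (suc j) (λ σ → deletion z σ ⊕ b σ)
      deletion-chain b-chain σ ¬face = trans (+-cong deletion≈0
        (b-chain σ λ (face , size) → ¬face (link⇒deletion face , size))) (+-identityʳ 0#)
        where
        deletion≈0 : deletion z σ ≈ 0#
        deletion≈0 with lookup σ v in σv
        ... | true  = refl
        ... | false = chain σ λ ((σ⊆S , ind) , size) → ¬face
          (((λ u∈ → ∈-without⁺ (σ⊆S u∈) (λ { ≡.refl → lookup⇒∉ σv u∈ })) , ind) , size)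

-- Pentagons, packings and the matchings they contain.

module Combinatorics {n : ℕ} (G : Graph n) where
  open Graph G

  -- An induced 5-cycle. The non-edges are oriented cyclically so that `rotate` merely permutes the
  -- components.
  Pentagon : (a b c d e : Fin n) → Set
  Pentagon a b c d e =
    (Adj a b × Adj b c × Adj c d × Adj d e × Adj e a) ×
    (¬ Adj a c × ¬ Adj b d × ¬ Adj c e × ¬ Adj d a × ¬ Adj e b)

  rotate : ∀ {a b c d e} → Pentagon a b c d e → Pentagon b c d e a
  rotate ((ab , bc , cd , de , ea) , (ac , bd , ce , da , eb)) =
    (bc , cd , de , ea , ab) , (bd , ce , da , eb , ac)

  adj⇒≢ : ∀ {x y} → Adj x y → x ≢ y
  adj⇒≢ x~y ≡.refl = irrefl _ x~y

  separated⇒≢ : ∀ {x y z} → Adj x z → ¬ Adj y z → x ≢ y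
  separated⇒≢ x~z y≁z ≡.refl = y≁z x~z

  -- Two vertices at distance two differ because one of them has a neighbour on the pentagon that
  -- the other lacks.
  pentagon-unique : ∀ {a b c d e} → Pentagon a b c d e → Unique (a ∷ b ∷ c ∷ d ∷ e ∷ [])
  pentagon-unique ((ab , bc , cd , de , ea) , (ac , bd , ce , da , eb)) =
    (adj⇒≢ ab ∷ separated⇒≢ (sym ea) ce ∷ separated⇒≢ ab (bd ∘ sym) ∷ adj⇒≢ (sym ea) ∷ []) ∷
    (adj⇒≢ bc ∷ separated⇒≢ (sym ab) da ∷ separated⇒≢ bc (ce ∘ sym) ∷ []) ∷
    (adj⇒≢ cd ∷ separated⇒≢ (sym bc) eb ∷ []) ∷
    (adj⇒≢ de ∷ []) ∷ [] ∷ []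

  Apart : List (Fin n) → List (Fin n) → Set
  Apart xs ys = ∀ {x y} → x ∈ₗ xs → y ∈ₗ ys → x ≢ y × ¬ Adj x y

  apart-sym : ∀ {xs ys} → Apart xs ys → Apart ys xs
  apart-sym apart y∈ x∈ = let x≢y , x≁y = apart x∈ y∈ in ≢-sym x≢y , x≁y ∘ sym

  apart-++ʳ : ∀ {xs ys zs} → Apart xs ys → Apart xs zs → Apart xs (ys ++ zs)
  apart-++ʳ {ys = ys} xs-ys xs-zs x∈ y∈ with ∈-++⁻ ys y∈
  ... | inj₁ y∈ys = xs-ys x∈ y∈ys
  ... | inj₂ y∈zs = xs-zs x∈ y∈zs

  data Block : List (Fin n) → ℕ → Set where
    edge     : ∀ {x y} → Adj x y → Block (x ∷ y ∷ []) 1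
    pentagon : ∀ {a b c d e} → Pentagon a b c d e → Block (a ∷ b ∷ c ∷ d ∷ e ∷ []) 2

  -- Induced subgraphs that are disjoint unions of edges and pentagons, indexed
  -- by their vertices and their matching number.
  data Packing : List (Fin n) → ℕ → Set where
    []  : Packing [] 0
    add : ∀ {xs s l k} → Block xs s → Apart xs l → Packing l k → Packing (xs ++ l) (s + k)

  PackingIn : Subset n → ℕ → Set
  PackingIn S k = ∃[ l ] Packing l k × All (_∈ S) l

  -- A packing with one block brought out. Inclusions in `l` suffice and avoid permutations of the
  -- vertex list.
  record Split (l : List (Fin n)) (k : ℕ) : Set where
    constructor split
    field
      {block rest}         : List (Fin n)
      {blockSize restSize} : ℕ
      isBlock              : Block block blockSize
      apart                : Apart block rest
      packing              : Packing rest restSize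
      size                 : blockSize + restSize ≡ k
      block⊆               : block ⊆ₗ l
      rest⊆                : rest ⊆ₗ l

  split-head : ∀ {xs s l k} → Block xs s → Apart xs l → Packing l k → Split (xs ++ l) (s + k)
  split-head {xs} B apart P = split B apart P ≡.refl ∈-++⁺ˡ (∈-++⁺ʳ xs)

  split-tail : ∀ {xs s l k} → Block xs s → Apart xs l → Split l k → Split (xs ++ l) (s + k)
  split-tail {xs} {s} B apart (split {rest = rest} {s′} {k′} B′ apart′ P size block⊆ rest⊆) =
    split B′
      (apart-++ʳ {ys = xs} (λ x∈ y∈ → apart-sym apart (block⊆ x∈) y∈) apart′)
      (add B (λ x∈ y∈ → apart x∈ (rest⊆ y∈)) P)
      (≡.trans (ℕ.+-comm s′ _) (≡.trans (ℕ.+-assoc s _ s′) (cong (s +_) (≡.trans (ℕ.+-comm _ s′) size))))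
      (∈-++⁺ʳ xs ∘ block⊆)
      λ x∈ → [ ∈-++⁺ˡ , ∈-++⁺ʳ xs ∘ rest⊆ ] (∈-++⁻ xs x∈)

  split-at : ∀ {l k x} → Packing l k → x ∈ₗ l → Σ[ P ∈ Split l k ] x ∈ₗ Split.block P
  split-at (add {xs} B apart P) x∈ with ∈-++⁻ xs x∈
  ... | inj₁ x∈xs = split-head B apart P , x∈xs
  ... | inj₂ x∈l  = let P′ , x∈′ = split-at P x∈l in split-tail B apart P′ , x∈′

  -- Edges and pentagons are vertex-transitive, so any vertex can be listed first.
  orient : ∀ {xs s x} → Block xs s → x ∈ₗ xs → ∃[ ys ] Block (x ∷ ys) s × (x ∷ ys) ⊆ₗ xs
  orient (edge xy) (here ≡.refl)         = _ , edge xy , id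
  orient (edge xy) (there (here ≡.refl)) = _ , edge (sym xy) , λ where
    (here eq)         → there (here eq)
    (there (here eq)) → here eq
  orient (pentagon p) = turn p
    where
    shift : ∀ {a b c d e : Fin n} → (b ∷ c ∷ d ∷ e ∷ a ∷ []) ⊆ₗ (a ∷ b ∷ c ∷ d ∷ e ∷ [])
    shift {a} {b} {c} {d} {e} y∈ with ∈-++⁻ (b ∷ c ∷ d ∷ e ∷ []) y∈
    ... | inj₁ y∈′       = there y∈′
    ... | inj₂ (here eq) = here eq
    turn : ∀ {a b c d e x} → Pentagon a b c d e → x ∈ₗ (a ∷ b ∷ c ∷ d ∷ e ∷ []) →
      ∃[ ys ] Block (x ∷ ys) 2 × (x ∷ ys) ⊆ₗ (a ∷ b ∷ c ∷ d ∷ e ∷ [])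
    turn p (here ≡.refl)                         = _ , pentagon p , id
    turn p (there (here ≡.refl))                 = _ , pentagon (rotate p) , shift
    turn p (there (there (here ≡.refl)))         = _ , pentagon (rotate (rotate p)) , shift ∘ shift
    turn p (there (there (there (here ≡.refl)))) =
      _ , pentagon (rotate (rotate (rotate p))) , shift ∘ shift ∘ shift
    turn p (there (there (there (there (here ≡.refl))))) =
      _ , pentagon (rotate (rotate (rotate (rotate p)))) , shift ∘ shift ∘ shift ∘ shift

  -- Consecutive pairs of the list are adjacent: a repetition-free such list is
  -- a matching with k edges.
  data Paired : List (Fin n) → ℕ → Set where
    []  : Paired [] 0
    _∷_ : ∀ {x y l k} → Adj x y → Paired l k → Paired (x ∷ y ∷ l) (suc k)

  _++ᴾ_ : ∀ {l l′ k k′} → Paired l k → Paired l′ k′ → Paired (l ++ l′) (k + k′)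
  []        ++ᴾ q = q
  (xy ∷ p) ++ᴾ q = xy ∷ (p ++ᴾ q)

  MatchingsBoundedBy : Subset n → ℕ → Set
  MatchingsBoundedBy S m = ∀ {l k} → Unique l → All (_∈ S) l → Paired l k → k ≤ m

  -- A matching with `k` edges inside `l`. It need not use all of `l`: in a pentagon one vertex
  -- stays unmatched.
  record Cover (l : List (Fin n)) (k : ℕ) : Set where
    constructor cover
    field
      {list} : List (Fin n)
      unique : Unique list
      paired : Paired list k
      list⊆  : list ⊆ₗ l

  block-cover : ∀ {xs s} → Block xs s → Cover xs s
  block-cover (edge xy) = cover ((adj⇒≢ xy ∷ []) ∷ [] ∷ []) (xy ∷ []) id
  block-cover {a ∷ b ∷ c ∷ d ∷ e ∷ []} (pentagon p@((ab , _ , cd , _) , _)) =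
    cover (Unique.take⁺ 4 (pentagon-unique p)) (ab ∷ cd ∷ []) (∈-++⁺ˡ {xs = a ∷ b ∷ c ∷ d ∷ []})

  cover-++ : ∀ {xs ys j k} → (∀ {x} → x ∈ₗ xs → ¬ x ∈ₗ ys) → Cover xs j → Cover ys k → Cover (xs ++ ys) (j + k)
  cover-++ {xs} disjoint (cover {l} u p l⊆) (cover {l′} u′ p′ l′⊆) =
    cover (Unique.++⁺ u u′ λ (x∈ , x∈′) → disjoint (l⊆ x∈) (l′⊆ x∈′)) (p ++ᴾ p′)
      λ x∈ → [ ∈-++⁺ˡ ∘ l⊆ , ∈-++⁺ʳ xs ∘ l′⊆ ] (∈-++⁻ l x∈)

  packing-cover : ∀ {l k} → Packing l k → Cover l k
  packing-cover []              = cover [] [] id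
  packing-cover (add B apart P) =
    cover-++ (λ x∈ x∈′ → proj₁ (apart x∈ x∈′) ≡.refl) (block-cover B) (packing-cover P)

  -- A packing of size `k` contains a matching of `k` edges, to which the `j` disjoint edges on `xs`
  -- are added. Contradictions with the matching number are all obtained this way.
  augment : ∀ {S m xs j l k} → MatchingsBoundedBy S m →
    Unique xs → Paired xs j → All (_∈ S) xs → Packing l k → All (_∈ S) l →
    All (λ x → ¬ x ∈ₗ l) xs → j + k ≤ m
  augment {S} bound unique paired xs⊆S P l⊆S xs∉l =
    bound u (All.tabulate (λ x∈ → All.lookup (All.++⁺ xs⊆S l⊆S) (⊆xs++l x∈))) p
    where open Cover (cover-++ (All.lookup xs∉l) (cover unique paired id) (packing-cover P))
            renaming (unique to u; paired to p; list⊆ to ⊆xs++l)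

  -- The combinatorial step: packings away from each vertex, but none of size `suc k` in `S`, leave
  -- no edge in `S`.

  module Step {S : Subset n} {k : ℕ}
    (bound   : MatchingsBoundedBy S (suc k))
    (none    : ¬ PackingIn S (suc k))
    (packing : ∀ {v} → v ∈ S → PackingIn (awayFrom G S v) k)
    where

    away⇒∈ : ∀ {v l} → All (_∈ awayFrom G S v) l → All (_∈ S) l
    away⇒∈ = All.map (proj₁ ∘ ∈-awayFrom⁻ G)

    away-≢ : ∀ {v y} → y ∈ awayFrom G S v → v ≢ y
    away-≢ y∈ = ≢-sym (proj₁ (proj₂ (∈-awayFrom⁻ G y∈)))

    away-≁ : ∀ {v y} → y ∈ awayFrom G S v → ¬ Adj v y
    away-≁ y∈ = proj₂ (proj₂ (∈-awayFrom⁻ G y∈))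

    neighbour-≢ : ∀ {u v y} → Adj v u → y ∈ awayFrom G S v → u ≢ y
    neighbour-≢ v~u y∈ ≡.refl = away-≁ y∈ v~u

    -- Otherwise the edge `u v` could be added to the packing away from `v`.
    touches : ∀ {u v l} → u ∈ S → v ∈ S → Adj v u → Packing l k → All (_∈ awayFrom G S v) l →
      ¬ (∀ {y} → y ∈ₗ l → ¬ Adj u y)
    touches {u} {v} {l} u∈S v∈S v~u P l⊆ u≁ =
      none (_ , add (edge (sym v~u)) apart P , u∈S ∷ v∈S ∷ away⇒∈ l⊆)
      where
      apart : Apart (u ∷ v ∷ []) l
      apart (here ≡.refl)         y∈ = neighbour-≢ v~u (All.lookup l⊆ y∈) , u≁ y∈
      apart (there (here ≡.refl)) y∈ = away-≢ (All.lookup l⊆ y∈) , away-≁ (All.lookup l⊆ y∈)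

    -- By `touches`, `u` has a neighbour in the packing away from `v`, and all vertices there are
    -- distinct from `v` and not adjacent to it.
    private-neighbour : ∀ {u v} → u ∈ S → v ∈ S → Adj u v →
      ∃[ w ] w ∈ S × Adj u w × w ≢ v × ¬ Adj v w
    private-neighbour {u} {v} u∈S v∈S u~v
      with any? (λ w → w ∈? S ×-dec adj? u w ×-dec ¬? (w ≟ v) ×-dec ¬? (adj? v w))
    ... | yes found = found
    ... | no ¬found =
      let l , P , l⊆ = packing v∈S in
      ⊥-elim (touches u∈S v∈S (sym u~v) P l⊆ λ y∈ u~y →
        let y∈S , y≢v , v≁y = ∈-awayFrom⁻ G (All.lookup l⊆ y∈) in ¬found (_ , y∈S , u~y , y≢v , v≁y))

    -- Here `x y` is the edge touched by `u` in the packing away from `v`, and `rest` is the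
    -- remainder of that packing. That `u` and `t` are not joined to `rest` is derived later from
    -- the degrees.
    record PentagonAt (v u : Fin n) : Set where
      field
        {x y t}    : Fin n
        isPentagon : Pentagon v u x y t
        x∈S        : x ∈ S
        y∈S        : y ∈ S
        t∈S        : t ∈ S
        {rest}     : List (Fin n)
        {restSize} : ℕ
        isPacking  : Packing rest restSize
        size       : suc restSize ≡ k
        rest⊆      : All (_∈ awayFrom G S v) rest
        apart      : Apart (x ∷ y ∷ []) rest
        degree-2   : ∀ {w} → w ∈ S → Adj v w → w ≡ u ⊎ w ≡ t

    module _ {v u u′ : Fin n} (v∈S : v ∈ S) (u∈S : u ∈ S) (u′∈S : u′ ∈ S) (v~u : Adj v u) (v~u′ : Adj v u′)
      (u′≢u : u′ ≢ u) (u≁u′ : ¬ Adj u u′) where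

      -- The edges `v u′`, `u x`, `b c` and `d e` with a matching of the remaining packing make
      -- `4 + k′` edges, against the bound `3 + k′`.
      too-many-at-pentagon : ∀ {x b c d e l k′} → Adj u x → Pentagon x b c d e →
        All (_∈ awayFrom G S v) (x ∷ b ∷ c ∷ d ∷ e ∷ []) →
        Apart (x ∷ b ∷ c ∷ d ∷ e ∷ []) l → Packing l k′ → All (_∈ awayFrom G S v) l → 2 + k′ ≢ k
      too-many-at-pentagon u~x p@((_ , bc , _ , de , _) , _) ring⊆ apart P l⊆ ≡.refl =
        ℕ.<-irrefl ≡.refl (augment bound
          ((adj⇒≢ v~u′ ∷ adj⇒≢ v~u ∷ All.map away-≢ ring⊆) ∷
           (u′≢u ∷ All.map (neighbour-≢ v~u′) ring⊆) ∷
           All.map (neighbour-≢ v~u) ring⊆ ∷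
           pentagon-unique p)
          (v~u′ ∷ u~x ∷ bc ∷ de ∷ [])
          (v∈S ∷ u′∈S ∷ u∈S ∷ away⇒∈ ring⊆)
          P (away⇒∈ l⊆)
          ((λ v∈ → away-≢ (All.lookup l⊆ v∈) ≡.refl) ∷
           (λ u′∈ → neighbour-≢ v~u′ (All.lookup l⊆ u′∈) ≡.refl) ∷
           (λ u∈ → neighbour-≢ v~u (All.lookup l⊆ u∈) ≡.refl) ∷
           All.tabulate (λ x∈ x∈l → proj₁ (apart x∈ x∈l) ≡.refl)))

    module _ {v x y : Fin n} {l : List (Fin n)} {k′ : ℕ} (v∈S : v ∈ S) (x∈ : x ∈ awayFrom G S v) (y∈ : y ∈ awayFrom G S v) (x~y : Adj x y)
      (apart : Apart (x ∷ y ∷ []) l) (P : Packing l k′) (l⊆ : All (_∈ awayFrom G S v) l)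
      (size : suc k′ ≡ k) where

      private
        -- The bound is `2 + k′`, so three edges disjoint from the remaining packing are one too
        -- many.
        too-large : ¬ (3 + k′ ≤ suc k)
        too-large 3+k′≤ = ℕ.<-irrefl (cong suc size) 3+k′≤
        x∈S = proj₁ (∈-awayFrom⁻ G x∈)
        y∈S = proj₁ (∈-awayFrom⁻ G y∈)
        v∉l : ¬ v ∈ₗ l
        v∉l v∈ = away-≢ (All.lookup l⊆ v∈) ≡.refl
        neighbour∉l : ∀ {u} → Adj v u → ¬ u ∈ₗ l
        neighbour∉l v~u u∈ = away-≁ (All.lookup l⊆ u∈) v~u
        x∉l : ¬ x ∈ₗ l
        x∉l x∈l = proj₁ (apart (here ≡.refl) x∈l) ≡.refl
        y∉l : ¬ y ∈ₗ l
        y∉l y∈l = proj₁ (apart (there (here ≡.refl)) y∈l) ≡.refl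

      -- Otherwise yz, xr and vr′ replace xy.
      far-end-neighbour : ∀ {r r′ z} → r ∈ S → r′ ∈ S → Adj v r → Adj v r′ → r ≢ r′ → Adj x r →
        z ∈ S → Adj y z → z ≢ x → Adj v z
      far-end-neighbour {r} {r′} {z} r∈S r′∈S v~r v~r′ r≢r′ x~r z∈S y~z z≢x with adj? v z
      ... | yes v~z = v~z
      ... | no  v≁z = ⊥-elim (too-large (augment bound
        ((adj⇒≢ y~z ∷ ≢-sym (adj⇒≢ x~y) ∷ ≢-sym (neighbour-≢ v~r y∈) ∷ ≢-sym (away-≢ y∈) ∷ ≢-sym (neighbour-≢ v~r′ y∈) ∷ []) ∷
         (z≢x ∷ ≢-sym (z≢ v~r) ∷ (λ { ≡.refl → away-≁ y∈ (sym y~z) }) ∷ ≢-sym (z≢ v~r′) ∷ []) ∷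
         (adj⇒≢ x~r ∷ ≢-sym (away-≢ x∈) ∷ ≢-sym (neighbour-≢ v~r′ x∈) ∷ []) ∷
         (≢-sym (adj⇒≢ v~r) ∷ r≢r′ ∷ []) ∷
         (adj⇒≢ v~r′ ∷ []) ∷ [] ∷ [])
        (y~z ∷ x~r ∷ v~r′ ∷ [])
        (y∈S ∷ z∈S ∷ x∈S ∷ r∈S ∷ v∈S ∷ r′∈S ∷ [])
        P (away⇒∈ l⊆)
        (y∉l ∷ (λ z∈l → proj₂ (apart (there (here ≡.refl)) z∈l) y~z) ∷ x∉l ∷
         neighbour∉l v~r ∷ v∉l ∷ neighbour∉l v~r′ ∷ [])))
        where
        z≢ : ∀ {w} → Adj v w → w ≢ z
        z≢ v~w ≡.refl = v≁z v~w

      -- Otherwise xr, yt and vw replace xy.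
      only-two-neighbours : ∀ {r t w} → r ∈ S → t ∈ S → Adj v r → Adj v t → r ≢ t → Adj x r → Adj y t →
        w ∈ S → Adj v w → w ≡ r ⊎ w ≡ t
      only-two-neighbours {r} {t} {w} r∈S t∈S v~r v~t r≢t x~r y~t w∈S v~w with w ≟ r | w ≟ t
      ... | yes w≡r | _       = inj₁ w≡r
      ... | no _    | yes w≡t = inj₂ w≡t
      ... | no w≢r  | no w≢t  = ⊥-elim (too-large (augment bound
        ((adj⇒≢ x~r ∷ adj⇒≢ x~y ∷ ≢-sym (neighbour-≢ v~t x∈) ∷ ≢-sym (away-≢ x∈) ∷ ≢-sym (neighbour-≢ v~w x∈) ∷ []) ∷
         (neighbour-≢ v~r y∈ ∷ r≢t ∷ ≢-sym (adj⇒≢ v~r) ∷ ≢-sym w≢r ∷ []) ∷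
         (adj⇒≢ y~t ∷ ≢-sym (away-≢ y∈) ∷ ≢-sym (neighbour-≢ v~w y∈) ∷ []) ∷
         (≢-sym (adj⇒≢ v~t) ∷ ≢-sym w≢t ∷ []) ∷
         (adj⇒≢ v~w ∷ []) ∷ [] ∷ [])
        (x~r ∷ y~t ∷ v~w ∷ [])
        (x∈S ∷ r∈S ∷ y∈S ∷ t∈S ∷ v∈S ∷ w∈S ∷ [])
        P (away⇒∈ l⊆)
        (x∉l ∷ neighbour∉l v~r ∷ y∉l ∷ neighbour∉l v~t ∷ v∉l ∷ neighbour∉l v~w ∷ [])))

    swap-apart : ∀ {x y l} → Apart (x ∷ y ∷ []) l → Apart (y ∷ x ∷ []) l
    swap-apart apart (here eq)         = apart (there (here eq))
    swap-apart apart (there (here eq)) = apart (here eq)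

    pentagon-at : ∀ {v u} → v ∈ S → u ∈ S → Adj v u → PentagonAt v u
    pentagon-at {v} {u} v∈S u∈S v~u
      with l , P , l⊆ ← packing v∈S
      with u′ , u′∈S , v~u′ , u′≢u , u≁u′ ← private-neighbour v∈S u∈S v~u
      with Any.any? (adj? u) l
    ... | no ¬touch = ⊥-elim (touches u∈S v∈S v~u P l⊆ λ y∈ u~y → ¬touch (Any.map (λ { ≡.refl → u~y }) y∈))
    ... | yes touch
      with x , x∈l , u~x ← find-∈ touch
      with split B₀ apart₀ P′ size block⊆ rest⊆ , x∈B₀ ← split-at P x∈l
      with orient B₀ x∈B₀
    ... | _ , pentagon p , p⊆ = ⊥-elim (too-many-at-pentagon v∈S u∈S u′∈S v~u v~u′ u′≢u u≁u′ u~x p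
            (All.tabulate (All.lookup l⊆ ∘ block⊆ ∘ p⊆)) (λ x∈ y∈ → apart₀ (p⊆ x∈) y∈)
            P′ (All.tabulate (All.lookup l⊆ ∘ rest⊆)) size)
    ... | y ∷ [] , edge x~y , p⊆
      with x∈ ∷ y∈ ∷ [] ← All.tabulate {xs = x ∷ y ∷ []} (All.lookup l⊆ ∘ block⊆ ∘ p⊆)
      with x∈S ← proj₁ (∈-awayFrom⁻ G x∈) | y∈S ← proj₁ (∈-awayFrom⁻ G y∈)
      -- Both `t` and `r` turn out to be adjacent to `v`, hence are its only neighbours. As `u` is
      -- adjacent to `x` and `t` is not, `u` is `r` and `u′` is `t`.
      with t , t∈S , y~t , t≢x , x≁t ← private-neighbour y∈S x∈S (sym x~y)
      with r , r∈S , x~r , r≢y , y≁r ← private-neighbour x∈S y∈S x~y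
      = result (two u∈S v~u) (two u′∈S v~u′)
      where
      apart : Apart (x ∷ y ∷ []) _
      apart x∈ y∈ = apart₀ (p⊆ x∈) y∈
      P′⊆ = All.tabulate (All.lookup l⊆ ∘ rest⊆)
      t≢u : t ≢ u
      t≢u ≡.refl = x≁t (sym u~x)
      v~t : Adj v t
      v~t = far-end-neighbour v∈S x∈ y∈ x~y apart P′ P′⊆ size
        u∈S u′∈S v~u v~u′ (≢-sym u′≢u) (sym u~x) t∈S y~t t≢x
      v~r : Adj v r
      v~r = far-end-neighbour v∈S y∈ x∈ (sym x~y) (swap-apart apart) P′ P′⊆ size
        t∈S u∈S v~t v~u t≢u y~t r∈S x~r r≢y
      two : ∀ {w} → w ∈ S → Adj v w → w ≡ r ⊎ w ≡ t
      two = only-two-neighbours v∈S x∈ y∈ x~y apart P′ P′⊆ size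
        r∈S t∈S v~r v~t (λ { ≡.refl → y≁r y~t }) x~r y~t
      result : u ≡ r ⊎ u ≡ t → u′ ≡ r ⊎ u′ ≡ t → PentagonAt v u
      result (inj₂ u≡t)    _             = ⊥-elim (t≢u (≡.sym u≡t))
      result (inj₁ ≡.refl) (inj₁ u′≡u)   = ⊥-elim (u′≢u u′≡u)
      result (inj₁ ≡.refl) (inj₂ ≡.refl) = record
        { isPentagon = (v~u , u~x , x~y , y~t , sym v~t)
                     , (away-≁ x∈ , y≁r ∘ sym , x≁t , away-≁ y∈ ∘ sym , u≁u′ ∘ sym)
        ; x∈S = x∈S ; y∈S = y∈S ; t∈S = t∈S
        ; isPacking = P′ ; size = size ; rest⊆ = P′⊆ ; apart = apart ; degree-2 = two
        }

    -- By `degree-2`, `v` has at most one neighbour in `S` besides `u`, and `z` is it.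
    other-neighbour : ∀ {v u w z} → v ∈ S → u ∈ S → Adj v u → z ∈ S → Adj v z → z ≢ u →
      w ∈ S → Adj v w → w ≡ u ⊎ w ≡ z
    other-neighbour v∈S u∈S v~u z∈S v~z z≢u w∈S v~w
      with degree-2 z∈S v~z | degree-2 w∈S v~w
      where open PentagonAt (pentagon-at v∈S u∈S v~u)
    ... | inj₁ z≡u    | _         = ⊥-elim (z≢u z≡u)
    ... | inj₂ ≡.refl | w≡u⊎w≡z   = w≡u⊎w≡z

    -- The pentagon at `v` and the remaining packing would form a packing of size `suc k`: `u` and
    -- `t` have both their neighbours on the pentagon, and the other three vertices are apart from
    -- `rest` by construction.
    no-edges : ∀ {v u} → v ∈ S → u ∈ S → ¬ Adj v u
    no-edges {v} {u} v∈S u∈S v~u = none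
      ( _ , ≡.subst (Packing _) (cong suc size) (add (pentagon isPentagon) pentagon-apart isPacking)
      , v∈S ∷ u∈S ∷ x∈S ∷ y∈S ∷ t∈S ∷ away⇒∈ rest⊆)
      where
      open PentagonAt (pentagon-at v∈S u∈S v~u)
      pentagon-apart : Apart (v ∷ u ∷ x ∷ y ∷ t ∷ []) rest
      pentagon-apart {y = w} z∈ w∈ = go z∈
        where
        w∈away = All.lookup rest⊆ w∈
        w∈S = proj₁ (∈-awayFrom⁻ G w∈away)
        v~t = sym (proj₂ (proj₂ (proj₂ (proj₂ (proj₁ isPentagon)))))
        not-touching : ∀ {p q} → p ∈ S → q ∈ S → Adj v p → Adj p q → q ≢ v → q ≢ w → p ≢ w × ¬ Adj p w
        not-touching p∈S q∈S v~p p~q q≢v q≢w = neighbour-≢ v~p w∈away , λ p~w →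
          [ (λ w≡v → away-≢ w∈away (≡.sym w≡v)) , (λ w≡q → q≢w (≡.sym w≡q)) ]
            (other-neighbour p∈S v∈S (sym v~p) q∈S p~q q≢v w∈S p~w)
        go : ∀ {z} → z ∈ₗ (v ∷ u ∷ x ∷ y ∷ t ∷ []) → z ≢ w × ¬ Adj z w
        go (here ≡.refl) = away-≢ w∈away , away-≁ w∈away
        go (there (here ≡.refl)) with (_ , u~x , _) , _ ← isPentagon | (_ ∷ v≢x ∷ _) ∷ _ ← pentagon-unique isPentagon =
          not-touching u∈S x∈S v~u u~x (≢-sym v≢x) (proj₁ (apart (here ≡.refl) w∈))
        go (there (there (here eq))) = apart (here eq) w∈
        go (there (there (there (here eq)))) = apart (there (here eq)) w∈
        go (there (there (there (there (here ≡.refl)))))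
          with (_ , _ , _ , y~t , _) , _ ← isPentagon | (_ ∷ _ ∷ v≢y ∷ _) ∷ _ ← pentagon-unique isPentagon =
          not-touching t∈S y∈S v~t (sym y~t) (≢-sym v≢y) (proj₁ (apart (there (here ≡.refl)) w∈))

lookup-injective : ∀ {a} {A : Set a} {xs : List A} → Unique xs →
  ∀ {i j} → List.lookup xs i ≡ List.lookup xs j → i ≡ j
lookup-injective {xs = _ ∷ _}  _             {zero}  {zero}  _  = ≡.refl
lookup-injective {xs = _ ∷ xs} (x≢ ∷ _)      {zero}  {suc j} eq = ⊥-elim (All.lookup x≢ (∈-lookup j) eq)
lookup-injective {xs = _ ∷ xs} (x≢ ∷ _)      {suc i} {zero}  eq = ⊥-elim (All.lookup x≢ (∈-lookup i) (≡.sym eq))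
lookup-injective {xs = _ ∷ _}  (_ ∷ unique)  {suc i} {suc j} eq = cong suc (lookup-injective unique eq)

-- The homological induction, and matchings read off from packings.

module Spanning {n : ℕ} (G : Graph n) where
  open Graph G
  open Combinatorics G
  open DecMembership (_≟_ {n}) using () renaming (_∈?_ to _∈ₗ?_)

  -- The edge `v u` extends every matching away from `v`.
  away-bound : ∀ {S m v u} → v ∈ S → u ∈ S → Adj v u →
    MatchingsBoundedBy S (suc m) → MatchingsBoundedBy (awayFrom G S v) m
  away-bound {v = v} v∈S u∈S v~u bound {l} unique l⊆ paired = ℕ.≤-pred (bound
    ((adj⇒≢ v~u ∷ All.map (λ y∈ → ≢-sym (proj₁ (proj₂ (∈-awayFrom⁻ G y∈)))) l⊆) ∷
     All.map (λ { y∈ ≡.refl → proj₂ (proj₂ (∈-awayFrom⁻ G y∈)) v~u }) l⊆ ∷ unique)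
    (v∈S ∷ u∈S ∷ All.map (proj₁ ∘ ∈-awayFrom⁻ G) l⊆)
    (v~u ∷ paired))

  without-bound : ∀ {S m v} → MatchingsBoundedBy S m → MatchingsBoundedBy (without S v) m
  without-bound bound unique l⊆ = bound unique (All.map (proj₁ ∘ ∈-without⁻) l⊆)

  -- The key claim in contrapositive form, by well-founded induction on the size of `S`.
  acyclic : ∀ {c ℓ} (R : CommutativeRing c ℓ) {S} k → Acc _<_ ∣ S ∣ →
    MatchingsBoundedBy S k → ¬ PackingIn S k → Acyclic R (Ind G S) k
  -- The empty packing always exists.
  acyclic R zero _ _ none = ⊥-elim (none (_ , [] , []))
  acyclic R {S} (suc k) (acc rec) bound none with nonempty? S
  ... | no  empty     = acyclic-empty R G empty
  ... | yes (v , v∈S) = λ z cycle ¬boundary →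
    -- Double negation commutes with the quantifier over the finitely many vertices, so packings may
    -- be assumed at all of them at once.
    sequence (RawMonad.rawApplicative ¬¬-Monad) (packing z cycle ¬boundary) λ packings →
      let u , u∈S , v~u = neighbour z cycle ¬boundary v∈S in
      Step.no-edges bound none (λ {v} → packings v) v∈S u∈S v~u
    where
    open ReducedHomology R using (IsCycle; IsBoundary)
    module _ (z : Subset n → CommutativeRing.Carrier R)
      (cycle : IsCycle (Ind G S) (suc k) z) (¬boundary : ¬ IsBoundary (Ind G S) (suc k) z) where
      neighbour : ∀ {v} → v ∈ S → ∃[ u ] u ∈ S × Adj v u
      neighbour {v} v∈S with any? (λ u → u ∈? S ×-dec adj? v u)
      ... | yes found = found
      ... | no ¬found =
        ⊥-elim (acyclic-isolated R G v∈S (λ u∈S v~u → ¬found (_ , u∈S , v~u)) z cycle ¬boundary)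

      packing : ∀ v → ¬ ¬ (v ∈ S → PackingIn (awayFrom G S v) k)
      packing v ¬packing = ¬packing λ v∈S →
        let u , u∈S , v~u = neighbour v∈S in
        -- Without a packing away from `v`, induction makes both deletion and link acyclic, so `z`
        -- would bound.
        ⊥-elim (acyclic-step R G v∈S
          (acyclic R (suc k) (rec (p⊂q⇒∣p∣<∣q∣
              ((proj₁ ∘ ∈-without⁻) , v , v∈S , λ v∈ → proj₂ (∈-without⁻ v∈) ≡.refl)))
            (without-bound bound)
            λ (l , P , l⊆) → none (l , P , All.map (proj₁ ∘ ∈-without⁻) l⊆))
          (acyclic R k (rec (p⊂q⇒∣p∣<∣q∣
              ((proj₁ ∘ ∈-awayFrom⁻ G) , v , v∈S , λ v∈ → proj₁ (proj₂ (∈-awayFrom⁻ G v∈)) ≡.refl)))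
            (away-bound v∈S u∈S v~u bound)
            λ P → ¬packing λ _ → P)
          z cycle ¬boundary)

  -- The clause on ends carries the induction: it keeps the edges found later disjoint from the
  -- current one.
  matching-of : ∀ {l k} → Unique l → Paired l k →
    ∃[ M ] IsMatching G M × length M ≡ k × (∀ {e} → e ∈ₗ M → ∀ {v} → _isEndOf_ G v e → v ∈ₗ l)
  matching-of _ [] = [] , [] , ≡.refl , λ ()
  matching-of ((_ ∷ x≢) ∷ y≢ ∷ unique) (xy ∷ paired) =
    let M , matching , size , ends = matching-of unique paired in
    record { adj = xy } ∷ M ,
    All.tabulate (λ e∈ → λ where
      (inj₁ ≡.refl) v∈ → All.lookup x≢ (ends e∈ v∈)
      (inj₂ ≡.refl) v∈ → All.lookup y≢ (ends e∈ v∈)) ∷ matching ,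
    cong suc size ,
    λ where
      (here ≡.refl) (inj₁ eq) → here eq
      (here ≡.refl) (inj₂ eq) → there (here eq)
      (there e∈)    v∈        → there (there (ends e∈ v∈))

  matching-bound : ∀ {m} → IsMatchingNumber G m → ∀ S → MatchingsBoundedBy S m
  matching-bound (_ , maximal) S unique _ paired =
    let M , matching , size , _ = matching-of unique paired in maximal _ (M , matching , size)

  -- When all blocks are edges, `Apart` is just what an induced matching requires.
  pentagon-or-induced-matching : ∀ {l k} → Packing l k →
    (Σ[ P ∈ Split l k ] Split.blockSize P ≡ 2) ⊎
    (∃[ M ] IsInducedMatching G M × length M ≡ k × (∀ {e} → e ∈ₗ M → ∀ {v} → _isEndOf_ G v e → v ∈ₗ l))
  pentagon-or-induced-matching [] = inj₂ ([] , ([] , []) , ≡.refl , λ ())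
  pentagon-or-induced-matching (add B@(pentagon _) apart P) = inj₁ (split-head B apart P , ≡.refl)
  pentagon-or-induced-matching (add B@(edge {x} {y} xy) apart P) with pentagon-or-induced-matching P
  ... | inj₁ (P′ , size) = inj₁ (split-tail B apart P′ , size)
  ... | inj₂ (M , (matching , induced) , size , ends) = inj₂
    ( record { adj = xy } ∷ M
    , ( All.tabulate (λ e∈ u∈ v∈ → proj₁ (apart (end∈ u∈) (ends e∈ v∈))) ∷ matching
      , All.tabulate (λ e∈ u∈ v∈ → proj₂ (apart (end∈ u∈) (ends e∈ v∈))) ∷ induced)
    , cong suc size
    , λ where
        (here ≡.refl) v∈ → ∈-++⁺ˡ (end∈ v∈)
        (there e∈)    v∈ → ∈-++⁺ʳ (x ∷ y ∷ []) (ends e∈ v∈))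
    where
    end∈ : ∀ {v} → v ≡ x ⊎ v ≡ y → v ∈ₗ (x ∷ y ∷ [])
    end∈ (inj₁ eq) = here eq
    end∈ (inj₂ eq) = there (here eq)

  -- A neighbour w outside the pentagon xs would extend the matching number of
  -- the pentagon by one.
  pentagon-closed : ∀ {m xs l k} → MatchingsBoundedBy ⊤ m → Block xs 2 → Apart xs l → Packing l k →
    2 + k ≡ m → ∀ {v w} → v ∈ₗ xs → Adj v w → w ∈ₗ xs
  pentagon-closed {xs = xs} bound B apart P ≡.refl {v} {w} v∈ v~w with w ∈ₗ? xs
  ... | yes w∈ = w∈
  ... | no  w∉ with orient B v∈
  ...   | _ , pentagon p@((_ , bc , _ , de , _) , _) , p⊆ =
    ⊥-elim (ℕ.<-irrefl ≡.refl (augment bound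
      (All.tabulate (λ y∈ → λ { ≡.refl → w∉ (p⊆ y∈) }) ∷ pentagon-unique p)
      (sym v~w ∷ bc ∷ de ∷ [])
      (All.universal (λ _ → ∈⊤) _) P (All.universal (λ _ → ∈⊤) _)
      ((λ w∈l → proj₂ (apart v∈ w∈l) v~w) ∷
       All.tabulate λ y∈ y∈l → proj₁ (apart (p⊆ y∈) y∈l) ≡.refl)))

  -- Spanning pentagons and the isomorphism with the 5-cycle.

  SpanningPentagon : Set
  SpanningPentagon = ∃[ a ] ∃[ b ] ∃[ c ] ∃[ d ] ∃[ e ]
    Pentagon a b c d e × (∀ w → w ∈ₗ (a ∷ b ∷ c ∷ d ∷ e ∷ []))

  spanning-pentagon? : Dec SpanningPentagon
  spanning-pentagon? = any? λ a → any? λ b → any? λ c → any? λ d → any? λ e →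
    ((adj? a b ×-dec adj? b c ×-dec adj? c d ×-dec adj? d e ×-dec adj? e a) ×-dec
     (¬? (adj? a c) ×-dec ¬? (adj? b d) ×-dec ¬? (adj? c e) ×-dec ¬? (adj? d a) ×-dec ¬? (adj? e b)))
    ×-dec all? λ w → w ∈ₗ? (a ∷ b ∷ c ∷ d ∷ e ∷ [])

  -- The pentagon is closed under adjacency, so every walk from it stays in it.
  spanning : ∀ {m xs l k} → Connected G → MatchingsBoundedBy ⊤ m → Block xs 2 → Apart xs l → Packing l k →
    2 + k ≡ m → SpanningPentagon
  spanning {xs = xs} connected bound B@(pentagon p) apart P size =
    _ , _ , _ , _ , _ , p , λ w → reach (connected _ w) (here ≡.refl)
    where
    reach : ∀ {u w} → Star Adj u w → u ∈ₗ xs → w ∈ₗ xs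
    reach ε          u∈ = u∈
    reach (u~v ◅ vs) u∈ = reach vs (pentagon-closed bound B apart P size u∈ u~v)

  ≅C₅ : SpanningPentagon → G ≅ C₅
  ≅C₅ (a , b , c , d , e , p@((ab , bc , cd , de , ea) , (ac , bd , ce , da , eb)) , all∈) = record
    { bijection = bijection
    -- `adj⇔` speaks of the vertices in cyclic order; it is transported along `vertex (to u) ≡ u`.
    ; preserves = λ u v → ≡.subst₂ (λ u′ v′ → Adj u′ v′ ⇔ Graph.Adj C₅ (to u) (to v))
        (strictlyInverseʳ u) (strictlyInverseʳ v) (adj⇔ (to u) (to v))
    }
    where
    vertices : List (Fin n)
    vertices = a ∷ b ∷ c ∷ d ∷ e ∷ []

    vertex : Fin 5 → Fin n
    vertex = List.lookup vertices

    bijection : Fin n ↔ Fin 5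
    bijection = ↔-sym (⤖⇒↔ (mk⤖ (lookup-injective (pentagon-unique p) ,
      λ w → Any.index (all∈ w) , λ { ≡.refl → ≡.sym (lookup-index (all∈ w)) })))

    open Inverse bijection using (to; strictlyInverseʳ)

    edge⇔ : ∀ {x y i j} → Adj x y → Graph.Adj C₅ i j → Adj x y ⇔ Graph.Adj C₅ i j
    edge⇔ x~y i~j = mk⇔ (λ _ → i~j) (λ _ → x~y)

    non-edge⇔ : ∀ {x y i j} → ¬ Adj x y → ¬ Graph.Adj C₅ i j → Adj x y ⇔ Graph.Adj C₅ i j
    non-edge⇔ x≁y i≁j = mk⇔ (⊥-elim ∘ x≁y) (⊥-elim ∘ i≁j)

    flip⇔ : ∀ {x y i j} → Adj x y ⇔ Graph.Adj C₅ i j → Adj y x ⇔ Graph.Adj C₅ j i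
    flip⇔ {i = i} {j} eq = mk⇔ (Graph.sym C₅ {i} {j} ∘ Equivalence.to eq ∘ sym)
                               (sym ∘ Equivalence.from eq ∘ Graph.sym C₅ {j} {i})

    adj⇔ : ∀ i j → Adj (vertex i) (vertex j) ⇔ Graph.Adj C₅ i j
    adj⇔ 0F 0F = non-edge⇔ (irrefl _) (Graph.irrefl C₅ 0F)
    adj⇔ 0F 1F = edge⇔ ab (inj₁ ≡.refl)
    adj⇔ 0F 2F = non-edge⇔ ac (from-no (Graph.adj? C₅ 0F 2F))
    adj⇔ 0F 3F = non-edge⇔ (da ∘ sym) (from-no (Graph.adj? C₅ 0F 3F))
    adj⇔ 0F 4F = edge⇔ (sym ea) (inj₂ ≡.refl)
    adj⇔ 1F 0F = flip⇔ (adj⇔ 0F 1F)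
    adj⇔ 1F 1F = non-edge⇔ (irrefl _) (Graph.irrefl C₅ 1F)
    adj⇔ 1F 2F = edge⇔ bc (inj₁ ≡.refl)
    adj⇔ 1F 3F = non-edge⇔ bd (from-no (Graph.adj? C₅ 1F 3F))
    adj⇔ 1F 4F = non-edge⇔ (eb ∘ sym) (from-no (Graph.adj? C₅ 1F 4F))
    adj⇔ 2F 0F = flip⇔ (adj⇔ 0F 2F)
    adj⇔ 2F 1F = flip⇔ (adj⇔ 1F 2F)
    adj⇔ 2F 2F = non-edge⇔ (irrefl _) (Graph.irrefl C₅ 2F)
    adj⇔ 2F 3F = edge⇔ cd (inj₁ ≡.refl)
    adj⇔ 2F 4F = non-edge⇔ ce (from-no (Graph.adj? C₅ 2F 4F))
    adj⇔ 3F 0F = flip⇔ (adj⇔ 0F 3F)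
    adj⇔ 3F 1F = flip⇔ (adj⇔ 1F 3F)
    adj⇔ 3F 2F = flip⇔ (adj⇔ 2F 3F)
    adj⇔ 3F 3F = non-edge⇔ (irrefl _) (Graph.irrefl C₅ 3F)
    adj⇔ 3F 4F = edge⇔ de (inj₁ ≡.refl)
    adj⇔ 4F 0F = flip⇔ (adj⇔ 0F 4F)
    adj⇔ 4F 1F = flip⇔ (adj⇔ 1F 4F)
    adj⇔ 4F 2F = flip⇔ (adj⇔ 2F 4F)
    adj⇔ 4F 3F = flip⇔ (adj⇔ 3F 4F)
    adj⇔ 4F 4F = non-edge⇔ (irrefl _) (Graph.irrefl C₅ 4F)

mainTheorem7 : ∀ {c ℓ₁ ℓ₂} (𝕜 : HeytingField c ℓ₁ ℓ₂) {n : ℕ} (G : Graph n) → Connected G →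
    ∀ {im reg m} → IsInducedMatchingNumber G im → IsRegularity 𝕜 G reg → IsMatchingNumber G m →
    im < reg → reg ≡ m → G ≅ C₅
mainTheorem7 𝕜 G connected {m = m} (_ , im-maximal) ((S , z , cycle , ¬boundary) , _) is-m im<m ≡.refl =
  ≅C₅ (decidable-stable spanning-pentagon? λ ¬spanning →
    acyclic commutativeRing m (<-wellFounded _) (matching-bound is-m S)
      (λ (_ , P , _) → ¬spanning (spanning-of P)) z cycle ¬boundary)
  where
  open HeytingCommutativeRing (HeytingField.heytingCommutativeRing 𝕜) using (commutativeRing)
  open Combinatorics G
  open Spanning G
  spanning-of : ∀ {l} → Packing l m → SpanningPentagon
  spanning-of P with pentagon-or-induced-matching P
  ... | inj₁ (split B apart P′ size _ _ , ≡.refl) =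
    spanning connected (matching-bound is-m ⊤) B apart P′ size
  -- An induced matching with `m` edges contradicts the strict inequality.
  ... | inj₂ (M , induced , size , _) = ⊥-elim (ℕ.<⇒≱ im<m (im-maximal _ (M , induced , size)))
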